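{- Let $1<a<b$ be coprime integers and let $D,E\subseteq G$ be subdiagrams. Then \[ B(\mathbf{1}_D,\mathbf{1}_E)=\mathtt{dinv}(D,E), \] where $\mathbf{1}_D,\mathbf{1}_E\in\mathbb{R}^G$ are the indicator vectors of $D$ and $E$.
   Context: Fix coprime integers $1<a<b$. Work in the grid $\mathbb{Z}^2$, with $+x$ pointing east and $+y$ pointing north; elements of $\mathbb{Z}^2$ are called cells. Let $g:\mathbb{Z}^2\to\mathbb{Z}$, $g(x,y)=ab-ax-by$. For a cell $c=(x,y)$ and an integer $k$, write $c-ka:=(x+k,y)$ and $c-kb:=(x,y+k)$. Let $G=\{(x,y)\in\mathbb{Z}_{\ge1}^2: g(x,y)>0\}$. A subdiagram is a subset $D\subseteq G$ such that whenever $(x,y)\in D$, $(x',y')\in G$, $x'\le x$ and $y'\le y$, we have $(x',y')\in D$. Define $K(d)=\mathbf{1}_{d\ge0}-\mathbf{1}_{d\ge a}-\mathbf{1}_{d\ge b}+\mathbf{1}_{d\ge a+b}$ for $d\in\mathbb{Z}$, the quadratic form $Q(\mathbf{n})=\sum_{i,j\in G}K(g(j)-g(i))\,n_in_j$ on $\mathbb{R}^G$, and let $B$ be the unique symmetric bilinear form on $\mathbb{R}^G$ with $B(\mathbf{n},\mathbf{n})=Q(\mathbf{n})$, namely \[ B(\mathbf{n},\mathbf{n}')=\tfrac12\sum_{i,j\in G}K(g(j)-g(i))\,(n_in'_j+n'_in_j). \] For a subdiagram $D$ and $c\in D$, let $\mathrm{arm}_D(c)=\max\{k\ge0: c-ka\in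 D\}$ and $\mathrm{leg}_D(c)=\max\{k\ge 0: c-kb\in D\}$. For subdiagrams $D,E$ and $c\in D\cap E$ define the mixed cross hook slopes \[ m_D^E(c)=\frac{\mathrm{leg}_E(c)}{\mathrm{arm}_D(c)+1},\qquad M_D^E(c)=\frac{\mathrm{leg}_E(c)+1}{\mathrm{arm}_D(c)}\] (with $M_D^E(c)=+\infty$ if $\mathrm{arm}_D(c)=0$), and the cross-dinv \[ \mathtt{dinv}(D,E)=\tfrac12\Big(\#\{c\in D\cap E: m_D^E(c)<\tfrac ab<M_D^E(c)\}+\#\{c\in D\cap E: m_E^D(c)<\tfrac ab<M_E^D(c)\}\Big). \] -}

module Defs where

open import Data.Bool.Base using (if_then_else_)
open import Data.Integer.Base as ℤ using (ℤ; +_; +≤+)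
import Data.Integer.Properties as ℤ
open import Data.Integer.Tactic.RingSolver using (solve-∀)
open import Data.List.Base using (List; []; _∷_; map; foldr; filter; length; upTo; cartesianProduct)
open import Data.List.Extrema.Nat using (max; v≤max⁺; argmax-all)
open import Data.List.Membership.Propositional using (_∈_)
open import Data.List.Membership.Propositional.Properties
  using (∈-filter⁺; ∈-cartesianProduct⁺; ∈-map⁺; ∈-upTo⁺)
open import Data.List.Relation.Unary.All as All using (All; []; _∷_)
open import Data.List.Relation.Unary.All.Properties using (all-filter)
import Data.List.Relation.Unary.Any as Any
open import Data.List.Relation.Unary.Unique.Propositional using (Unique)
import Data.List.Relation.Unary.Unique.Propositional.Properties as Unique
open import Data.Nat.Base as ℕ using (ℕ; zero; suc; NonZero)
import Data.Nat.Properties as ℕ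
open import Data.Product.Base using (∃; _×_; _,_; proj₁; proj₂)
open import Data.Rational.Base as ℚ using (ℚ; 0ℚ; ½; _/_)
import Data.Rational.Properties as ℚ
open import Data.Sum.Base using (inj₂)
open import Function.Base using (_∘_)
open import Level using (0ℓ)
open import Relation.Binary.Construct.Add.Supremum.Strict ℚ._<_ using (_<⁺_; <⁺-dec)
open import Relation.Binary.PropositionalEquality
  using (_≡_; refl; sym; trans; cong; cong₂; subst; subst₂; module ≡-Reasoning)
open import Relation.Nullary.Construct.Add.Supremum using (_⁺; [_]; ⊤⁺)
open import Relation.Nullary.Decidable using (Dec; does; _×-dec_)
open import Relation.Unary using (Pred; Decidable; _⊆_)

Cell : Set
Cell = ℤ × ℤ

-- c - k·a and c - k·b: these steps change the value of g by -k·a and -k·b.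
_-[_]a : Cell → ℕ → Cell
(x , y) -[ k ]a = x ℤ.+ + k , y

_-[_]b : Cell → ℕ → Cell
(x , y) -[ k ]b = x , y ℤ.+ + k

𝟏 : ∀ {p} {P : Set p} → Dec P → ℤ
𝟏 P? = if does P? then + 1 else + 0

fromℤ : ℤ → ℚ
fromℤ z = z / 1

-- ⊤⁺ is the added value +∞.
_/⁺_ : ℕ → ℕ → ℚ ⁺
p /⁺ zero    = ⊤⁺
p /⁺ (suc q) = [ + p / suc q ]

module _ (a b : ℕ) where

  g : Cell → ℤ
  g (x , y) = + a ℤ.* + b ℤ.- + a ℤ.* x ℤ.- + b ℤ.* y

  G : Pred Cell 0ℓ
  G c@(x , y) = + 1 ℤ.≤ x × + 1 ℤ.≤ y × + 0 ℤ.< g c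

  G? : Decidable G
  G? c@(x , y) = (+ 1 ℤ.≤? x) ×-dec (+ 1 ℤ.≤? y) ×-dec (+ 0 ℤ.<? g c)

  -- Every cell of G satisfies x < b and y < a, so G is finite and is listed
  -- without repetition by filtering this box; see ∈-cellsG and cellsG-unique.
  box : List Cell
  box = cartesianProduct (map +_ (upTo b)) (map +_ (upTo a))

  cellsG : List Cell
  cellsG = filter G? box

  elementsG : List (∃ G)
  elementsG = All.toList (all-filter G? box)

  ∑G : (∃ G → ℚ) → ℚ
  ∑G f = foldr ℚ._+_ 0ℚ (map f elementsG)

  K : ℤ → ℤ
  K d = 𝟏 (+ 0 ℤ.≤? d) ℤ.- 𝟏 (+ a ℤ.≤? d) ℤ.- 𝟏 (+ b ℤ.≤? d) ℤ.+ 𝟏 (+ (a ℕ.+ b) ℤ.≤? d)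

  Kᴳ : ∃ G → ∃ G → ℚ
  Kᴳ (i , _) (j , _) = fromℤ (K (g j ℤ.- g i))

  -- Vectors indexed by G, with rational entries.
  ℚ^G : Set
  ℚ^G = ∃ G → ℚ

  Q : ℚ^G → ℚ
  Q n = ∑G λ i → ∑G λ j → Kᴳ i j ℚ.* (n i ℚ.* n j)

  B : ℚ^G → ℚ^G → ℚ
  B n n′ = ½ ℚ.* (∑G λ i → ∑G λ j → Kᴳ i j ℚ.* (n i ℚ.* n′ j ℚ.+ n′ i ℚ.* n j))

  -- Membership is decidable, as it is classically for every subset of the
  -- finite set G; this is what makes indicators, maxima and counts computable.
  record Subdiagram : Set₁ where
    field
      Mem    : Pred Cell 0ℓ
      mem?   : Decidable Mem
      Mem⊆G  : Mem ⊆ G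
      closed : ∀ {x y x′ y′} → Mem (x , y) → G (x′ , y′) →
               x′ ℤ.≤ x → y′ ℤ.≤ y → Mem (x′ , y′)

module _ {a b : ℕ} where

  open Subdiagram

  infix 4 _∈ᴰ_ _∈ᴰ?_

  _∈ᴰ_ : Cell → Subdiagram a b → Set
  c ∈ᴰ D = Mem D c

  _∈ᴰ?_ : ∀ c (D : Subdiagram a b) → Dec (c ∈ᴰ D)
  c ∈ᴰ? D = mem? D c

  indicator : Subdiagram a b → ℚ^G a b
  indicator D (c , _) = fromℤ (𝟏 (c ∈ᴰ? D))

  -- For c ∈ D these are the maxima over all k ≥ 0, since no k ≥ b (resp. k ≥ a)
  -- can occur; see arm-∈, arm-max, leg-∈, leg-max. For c ∉ D they are not used.
  arm : Subdiagram a b → Cell → ℕ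
  arm D c = max 0 (filter (λ k → c -[ k ]a ∈ᴰ? D) (upTo b))

  leg : Subdiagram a b → Cell → ℕ
  leg D c = max 0 (filter (λ k → c -[ k ]b ∈ᴰ? D) (upTo a))

  m : Subdiagram a b → Subdiagram a b → Cell → ℚ
  m D E c = + leg E c / suc (arm D c)

  M : Subdiagram a b → Subdiagram a b → Cell → ℚ ⁺
  M D E c = suc (leg E c) /⁺ arm D c

  module _ .{{_ : NonZero b}} where

    Counted : Subdiagram a b → Subdiagram a b → Pred Cell 0ℓ
    Counted D E c = (c ∈ᴰ D × c ∈ᴰ E) × m D E c ℚ.< + a / b × [ + a / b ] <⁺ M D E c

    counted? : ∀ D E → Decidable (Counted D E)
    counted? D E c = ((c ∈ᴰ? D) ×-dec (c ∈ᴰ? E))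
      ×-dec (m D E c ℚ.<? + a / b) ×-dec <⁺-dec ℚ._<?_ [ + a / b ] (M D E c)

    -- D ∩ E ⊆ G, so it suffices to count over the cells of G.
    count : Subdiagram a b → Subdiagram a b → ℕ
    count D E = length (filter (counted? D E) (cellsG a b))

    dinv : Subdiagram a b → Subdiagram a b → ℚ
    dinv D E = ½ ℚ.* fromℤ (+ (count D E ℕ.+ count E D))

------------------------------------------------------------------------
-- The finite enumerations and bounded maxima above are the intended ones.

module _ (a b : ℕ) where

  private
    pos : ∀ {z} → + 1 ℤ.≤ z → ∃ λ k → z ≡ + suc k
    pos {+ suc k} _ = k , refl
    pos {+ zero} (+≤+ ())

    shift : ∀ A X Y → (A ℤ.- X ℤ.- Y) ℤ.+ (X ℤ.+ Y) ≡ A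
    shift = solve-∀

    bound : ∀ x y → + 0 ℤ.< g a b (+ x , + y) → a ℕ.* x ℕ.+ b ℕ.* y ℕ.< a ℕ.* b
    bound x y 0<g = ℤ.drop‿+<+ (subst₂ ℤ._<_ lhs rhs (ℤ.+-monoˡ-< XY 0<g))
      where
      XY = + a ℤ.* + x ℤ.+ + b ℤ.* + y
      lhs : + 0 ℤ.+ XY ≡ + (a ℕ.* x ℕ.+ b ℕ.* y)
      lhs = trans (ℤ.+-identityˡ XY) (cong₂ ℤ._+_ (sym (ℤ.pos-* a x)) (sym (ℤ.pos-* b y)))
      rhs : g a b (+ x , + y) ℤ.+ XY ≡ + (a ℕ.* b)
      rhs = trans (shift (+ a ℤ.* + b) (+ a ℤ.* + x) (+ b ℤ.* + y)) (sym (ℤ.pos-* a b))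

    x<b : ∀ x y → + 0 ℤ.< g a b (+ x , + y) → x ℕ.< b
    x<b x y p = ℕ.*-cancelˡ-< a x b (ℕ.≤-<-trans (ℕ.m≤m+n _ _) (bound x y p))

    y<a : ∀ x y → + 0 ℤ.< g a b (+ x , + y) → y ℕ.< a
    y<a x y p = ℕ.*-cancelˡ-< b y a
      (subst (b ℕ.* y ℕ.<_) (ℕ.*-comm a b) (ℕ.≤-<-trans (ℕ.m≤n+m _ _) (bound x y p)))

  G-bounded : ∀ {c} → G a b c → ∃ λ x → ∃ λ y → c ≡ (+ x , + y) × x ℕ.< b × y ℕ.< a
  G-bounded (1≤x , 1≤y , 0<g) with pos 1≤x | pos 1≤y
  ... | x , refl | y , refl = suc x , suc y , refl , x<b _ (suc y) 0<g , y<a (suc x) _ 0<g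

  ∈-cellsG : ∀ {c} → G a b c → c ∈ cellsG a b
  ∈-cellsG c∈G with G-bounded c∈G
  ... | x , y , refl , x<b , y<a = ∈-filter⁺ (G? a b)
    (∈-cartesianProduct⁺ (∈-map⁺ +_ (∈-upTo⁺ x<b)) (∈-map⁺ +_ (∈-upTo⁺ y<a))) c∈G

  cellsG-unique : Unique (cellsG a b)
  cellsG-unique = Unique.filter⁺ (G? a b) (Unique.cartesianProduct⁺
    (Unique.map⁺ ℤ.+-injective (Unique.upTo⁺ b)) (Unique.map⁺ ℤ.+-injective (Unique.upTo⁺ a)))

  elementsG-cells : map proj₁ (elementsG a b) ≡ cellsG a b
  elementsG-cells = go (all-filter (G? a b) (box a b))
    where
    go : ∀ {cs} (ps : All (G a b) cs) → map proj₁ (All.toList ps) ≡ cs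
    go []       = refl
    go (_ ∷ ps) = cong (_ ∷_) (go ps)

module _ {a b : ℕ} (D : Subdiagram a b) where

  open Subdiagram D

  private
    +-bound : ∀ {z k n} x → + 1 ℤ.≤ z → z ℤ.+ + k ≡ + x → x ℕ.< n → k ℕ.< n
    +-bound {+ z} {k} x _ refl x<n = ℕ.≤-<-trans (ℕ.m≤n+m k z) x<n

    max-∈ : ∀ {P : Pred ℕ 0ℓ} (P? : Decidable P) ks → P 0 → P (max 0 (filter P? ks))
    max-∈ P? ks p0 = argmax-all (λ k → k) p0 (all-filter P? ks)

    max-upper : ∀ {P : Pred ℕ 0ℓ} (P? : Decidable P) {n k} → k ℕ.< n → P k →
                k ℕ.≤ max 0 (filter P? (upTo n))
    max-upper P? k<n pk = v≤max⁺ 0 _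
      (inj₂ (Any.map ℕ.≤-reflexive (∈-filter⁺ P? (∈-upTo⁺ k<n) pk)))

  arm-∈ : ∀ {c} → c ∈ᴰ D → c -[ arm D c ]a ∈ᴰ D
  arm-∈ {x , y} c∈D = max-∈ (λ k → (x , y) -[ k ]a ∈ᴰ? D) (upTo b)
    (subst (λ z → Mem (z , y)) (sym (ℤ.+-identityʳ x)) c∈D)

  arm-max : ∀ {c k} → c ∈ᴰ D → c -[ k ]a ∈ᴰ D → k ℕ.≤ arm D c
  arm-max {c} c∈D k∈D with G-bounded a b (Mem⊆G k∈D)
  ... | x , _ , eq , x<b , _ = max-upper (λ k → c -[ k ]a ∈ᴰ? D)
    (+-bound x (proj₁ (Mem⊆G c∈D)) (cong proj₁ eq) x<b) k∈D

  leg-∈ : ∀ {c} → c ∈ᴰ D → c -[ leg D c ]b ∈ᴰ D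
  leg-∈ {x , y} c∈D = max-∈ (λ k → (x , y) -[ k ]b ∈ᴰ? D) (upTo a)
    (subst (λ z → Mem (x , z)) (sym (ℤ.+-identityʳ y)) c∈D)

  leg-max : ∀ {c k} → c ∈ᴰ D → c -[ k ]b ∈ᴰ D → k ℕ.≤ leg D c
  leg-max {c} c∈D k∈D with G-bounded a b (Mem⊆G k∈D)
  ... | _ , y , eq , _ , y<a = max-upper (λ k → c -[ k ]b ∈ᴰ? D)
    (+-bound y (proj₁ (proj₂ (Mem⊆G c∈D))) (cong proj₂ eq) y<a) k∈D

------------------------------------------------------------------------
-- B is symmetric and its diagonal is Q.

module _ (a b : ℕ) where

  private
    ∑-cong : ∀ {f h : ∃ (G a b) → ℚ} → (∀ i → f i ≡ h i) → ∑G a b f ≡ ∑G a b h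
    ∑-cong {f} {h} eq = go (elementsG a b)
      where
      go : ∀ is → foldr ℚ._+_ 0ℚ (map f is) ≡ foldr ℚ._+_ 0ℚ (map h is)
      go []       = refl
      go (i ∷ is) = cong₂ ℚ._+_ (eq i) (go is)

    ∑-*ˡ : ∀ q (f : ∃ (G a b) → ℚ) → q ℚ.* ∑G a b f ≡ ∑G a b (λ i → q ℚ.* f i)
    ∑-*ˡ q f = go (elementsG a b)
      where
      go : ∀ is → q ℚ.* foldr ℚ._+_ 0ℚ (map f is) ≡ foldr ℚ._+_ 0ℚ (map (λ i → q ℚ.* f i) is)
      go []       = ℚ.*-zeroʳ q
      go (i ∷ is) = trans (ℚ.*-distribˡ-+ q (f i) _) (cong (q ℚ.* f i ℚ.+_) (go is))

    half : ∀ k t → ½ ℚ.* (k ℚ.* (t ℚ.+ t)) ≡ k ℚ.* t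
    half k t = begin
      ½ ℚ.* (k ℚ.* (t ℚ.+ t))         ≡⟨ cong (½ ℚ.*_) (ℚ.*-distribˡ-+ k t t) ⟩
      ½ ℚ.* (k ℚ.* t ℚ.+ k ℚ.* t)     ≡⟨ ℚ.*-distribˡ-+ ½ (k ℚ.* t) (k ℚ.* t) ⟩
      ½ ℚ.* (k ℚ.* t) ℚ.+ ½ ℚ.* (k ℚ.* t) ≡⟨ ℚ.*-distribʳ-+ (k ℚ.* t) ½ ½ ⟨
      (½ ℚ.+ ½) ℚ.* (k ℚ.* t)         ≡⟨ ℚ.*-identityˡ (k ℚ.* t) ⟩
      k ℚ.* t                         ∎
      where open ≡-Reasoning

  B-sym : ∀ n n′ → B a b n n′ ≡ B a b n′ n
  B-sym n n′ = cong (½ ℚ.*_) (∑-cong λ i → ∑-cong λ j →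
    cong (Kᴳ a b i j ℚ.*_) (ℚ.+-comm (n i ℚ.* n′ j) (n′ i ℚ.* n j)))

  B-diag : ∀ n → B a b n n ≡ Q a b n
  B-diag n = trans (∑-*ˡ ½ _) (∑-cong λ i → trans (∑-*ˡ ½ _) (∑-cong λ j →
    half (Kᴳ a b i j) (n i ℚ.* n j)))

{-# OPTIONS --safe #-}
module Submission where

-- A cell of D ∩ E with arm r = arm_D and leg l = leg_E is counted by dinv iff
-- -b < b l - a r < a; call this indicator C(r, l). If κ is its mixed difference
-- (with C = 0 when r = -1 or l = -1), then C(r, l) is the sum of κ(s, u) over
-- s ≤ r, u ≤ l. A cell (x, y) of D ∩ E with a choice of s ≤ arm_D and u ≤ leg_E
-- is the same as a pair of cells (x + s, y) ∈ D, (x, y + u) ∈ E, so the count for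
-- (D, E) is a sum over pairs i ∈ D, j ∈ E with j weakly north-west of i. The
-- count for (E, D) is likewise a sum over pairs with j weakly south-east of i.
-- The two weights add up to K(d) + K(-d) with d = g(j) - g(i): off the diagonal
-- κ(s, u) = K(d) + K(-d); if one of i, j is strictly north-east of the other,
-- then |d| ≥ a + b and K(d) + K(-d) = 0; and for i = j the value 2 K(0) = 2 is
-- shared equally by the two sums.

open import Defs
open import Data.Bool.Base using (true; false)
open import Data.Integer.Base as ℤ using (ℤ; +_; -[1+_]; _+_; _*_; _-_; -_; _≤_; +≤+; +<+)
open import Data.Integer.Properties as ℤ using (_≤?_)
open import Data.Integer.Tactic.RingSolver using (solve-∀)
open import Data.List.Base
  using (List; []; _∷_; _++_; map; foldr; filter; length; upTo; cartesianProduct)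
import Data.List.Properties as List
open import Data.Nat.Base as ℕ using (ℕ; zero; suc; NonZero; _<_; z≤n; s≤s)
open import Data.Nat.Coprimality using (Coprime)
import Data.Nat.Properties as ℕ
open import Data.Product.Base using (∃; _×_; _,_; proj₁; proj₂)
open import Data.Rational.Base as ℚ using (ℚ; ½; _/_; toℚᵘ)
import Data.Rational.Properties as ℚ
import Data.Rational.Unnormalised.Base as ℚᵘ
import Data.Rational.Unnormalised.Properties as ℚᵘ
open import Function.Base using (_∘_)
open import Level using (Level)
open import Relation.Binary.Construct.Add.Supremum.Strict ℚ._<_ using (_<⁺_; [_]; [_]<⊤⁺; [<]-injective)
open import Relation.Binary.PropositionalEquality
  using (_≡_; refl; sym; trans; cong; cong₂; subst; module ≡-Reasoning)
open import Relation.Nullary.Construct.Add.Supremum using ([_])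
open import Relation.Nullary.Decidable using (Dec; yes; no; does; dec-true; dec-false; _×-dec_)
open import Relation.Nullary.Negation using (¬_; contradiction)
open import Relation.Unary using (Pred; Decidable)

open ≡-Reasoning

private
  variable
    ℓ ℓ′ : Level
    X Y : Set ℓ

-- Indicators and integer inequalities

𝟏-yes : {P : Set ℓ} (P? : Dec P) → P → 𝟏 P? ≡ + 1
𝟏-yes P? p rewrite dec-true P? p = refl

𝟏-no : {P : Set ℓ} (P? : Dec P) → ¬ P → 𝟏 P? ≡ + 0
𝟏-no P? ¬p rewrite dec-false P? ¬p = refl

𝟏-cong : {P : Set ℓ} {R : Set ℓ′} (P? : Dec P) (R? : Dec R) → (P → R) → (R → P) → 𝟏 P? ≡ 𝟏 R?
𝟏-cong P? (yes r) f g = 𝟏-yes P? (g r)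
𝟏-cong P? (no ¬r) f g = 𝟏-no P? (¬r ∘ f)

*-zeroˡ-≡ : ∀ {i} j → i ≡ + 0 → i * j ≡ + 0
*-zeroˡ-≡ j refl = refl

*-zeroʳ-≡ : ∀ i {j} → j ≡ + 0 → i * j ≡ + 0
*-zeroʳ-≡ i refl = ℤ.*-zeroʳ i

≤-resp-diff : ∀ {i j k l} → j - i ≡ l - k → i ≤ j → k ≤ l
≤-resp-diff eq i≤j = ℤ.0≤i-j⇒j≤i (subst (+ 0 ≤_) eq (ℤ.i≤j⇒0≤j-i i≤j))

-- Both comparisons depend only on the differences `j - i` and `l - k`. This converts the shifted
-- thresholds of `N` into the four thresholds of `K`.
𝟏-≤-cong : ∀ i j k l → j - i ≡ l - k → 𝟏 (i ≤? j) ≡ 𝟏 (k ≤? l)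
𝟏-≤-cong i j k l eq =
  𝟏-cong (i ≤? j) (k ≤? l) (≤-resp-diff eq) (≤-resp-diff (sym eq))

j-i≡+⇒i≤j : ∀ {i j} n → j - i ≡ + n → i ≤ j
j-i≡+⇒i≤j n eq = ℤ.0≤i-j⇒j≤i (subst (+ 0 ≤_) (sym eq) (+≤+ z≤n))

-- Brings a negative difference into constructor form, on which `κℤ` is known to vanish.
<⇒-≡-[1+] : ∀ {k n} → k < n → ∃ λ d → + k - + n ≡ -[1+ d ]
<⇒-≡-[1+] {k} {n} k<n with n ℕ.∸ k in eq | ℤ.m-n≡m⊖n k n | ℤ.⊖-< k<n
... | zero  | _  | _  = contradiction (ℕ.m∸n≡0⇒m≤n eq) (ℕ.<⇒≱ k<n)
... | suc d | e₁ | e₂ = d , trans e₁ e₂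

-- Finite sums

∑ : List X → (X → ℤ) → ℤ
∑ xs f = foldr _+_ (+ 0) (map f xs)

+-interchange : ∀ i j k l → (i + j) + (k + l) ≡ (i + k) + (j + l)
+-interchange = solve-∀

∑-cong : ∀ (xs : List X) {f g} → (∀ x → f x ≡ g x) → ∑ xs f ≡ ∑ xs g
∑-cong xs eq = cong (foldr _+_ (+ 0)) (List.map-cong eq xs)

∑-zero : ∀ (xs : List X) → ∑ xs (λ _ → + 0) ≡ + 0
∑-zero []       = refl
∑-zero (x ∷ xs) = trans (ℤ.+-identityˡ _) (∑-zero xs)

∑-+ : ∀ (xs : List X) f g → ∑ xs (λ x → f x + g x) ≡ ∑ xs f + ∑ xs g
∑-+ []       f g = refl
∑-+ (x ∷ xs) f g = trans (cong (_+_ (f x + g x)) (∑-+ xs f g)) (+-interchange (f x) _ _ _)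

∑-*ˡ : ∀ (xs : List X) i f → i * ∑ xs f ≡ ∑ xs (λ x → i * f x)
∑-*ˡ []       i f = ℤ.*-zeroʳ i
∑-*ˡ (x ∷ xs) i f = trans (ℤ.*-distribˡ-+ i (f x) _) (cong (_+_ (i * f x)) (∑-*ˡ xs i f))

∑-++ : ∀ (xs ys : List X) f → ∑ (xs ++ ys) f ≡ ∑ xs f + ∑ ys f
∑-++ []       ys f = sym (ℤ.+-identityˡ _)
∑-++ (x ∷ xs) ys f = trans (cong (_+_ (f x)) (∑-++ xs ys f)) (sym (ℤ.+-assoc (f x) _ _))

∑-map : ∀ (h : X → Y) xs f → ∑ (map h xs) f ≡ ∑ xs (f ∘ h)
∑-map h xs f = cong (foldr _+_ (+ 0)) (sym (List.map-∘ xs))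

∑-swap : ∀ (xs : List X) (ys : List Y) (f : X → Y → ℤ) →
         ∑ xs (λ x → ∑ ys (f x)) ≡ ∑ ys (λ y → ∑ xs (λ x → f x y))
∑-swap []       ys f = sym (∑-zero ys)
∑-swap (x ∷ xs) ys f = trans (cong (_+_ (∑ ys (f x))) (∑-swap xs ys f)) (sym (∑-+ ys (f x) _))

∑-product : ∀ (xs : List X) (ys : List Y) f →
            ∑ (cartesianProduct xs ys) f ≡ ∑ xs (λ x → ∑ ys (λ y → f (x , y)))
∑-product []       ys f = refl
∑-product (x ∷ xs) ys f = trans (∑-++ (map (x ,_) ys) _ f)
  (cong₂ _+_ (∑-map (x ,_) ys f) (∑-product xs ys f))

∑-filter : ∀ {P : Pred X ℓ} (P? : Decidable P) xs f → (∀ x → ¬ P x → f x ≡ + 0) →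
           ∑ (filter P? xs) f ≡ ∑ xs f
∑-filter P? []       f f≡0 = refl
∑-filter P? (x ∷ xs) f f≡0 with P? x
... | yes _  = cong (_+_ (f x)) (∑-filter P? xs f f≡0)
... | no ¬px = begin
  ∑ (filter P? xs) f ≡⟨ ∑-filter P? xs f f≡0 ⟩
  ∑ xs f             ≡⟨ ℤ.+-identityˡ _ ⟨
  + 0 + ∑ xs f       ≡⟨ cong (_+ ∑ xs f) (f≡0 x ¬px) ⟨
  f x + ∑ xs f       ∎

length-filter≡∑ : ∀ {P : Pred X ℓ} (P? : Decidable P) xs →
                  + length (filter P? xs) ≡ ∑ xs (𝟏 ∘ P?)
length-filter≡∑ P? []       = refl
length-filter≡∑ P? (x ∷ xs) with does (P? x)
... | true  = cong (_+_ (+ 1)) (length-filter≡∑ P? xs)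
... | false = trans (length-filter≡∑ P? xs) (sym (ℤ.+-identityˡ _))

∑-upTo-suc : ∀ n f → ∑ (upTo (suc n)) f ≡ f 0 + ∑ (upTo n) (f ∘ suc)
∑-upTo-suc n f = cong (λ ks → f 0 + foldr _+_ (+ 0) ks)
  (trans (List.map-applyUpTo suc f n) (sym (List.map-upTo (f ∘ suc) n)))

∑-upTo-cong : ∀ n {f g} → (∀ k → k < n → f k ≡ g k) → ∑ (upTo n) f ≡ ∑ (upTo n) g
∑-upTo-cong zero    eq = refl
∑-upTo-cong (suc n) {f} {g} eq = begin
  ∑ (upTo (suc n)) f         ≡⟨ ∑-upTo-suc n f ⟩
  f 0 + ∑ (upTo n) (f ∘ suc) ≡⟨ cong₂ _+_ (eq 0 (s≤s z≤n))
                                  (∑-upTo-cong n λ k k<n → eq (suc k) (s≤s k<n)) ⟩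
  g 0 + ∑ (upTo n) (g ∘ suc) ≡⟨ ∑-upTo-suc n g ⟨
  ∑ (upTo (suc n)) g         ∎

∑-upTo-+ : ∀ m n f → ∑ (upTo (m ℕ.+ n)) f ≡ ∑ (upTo m) f + ∑ (upTo n) (λ k → f (m ℕ.+ k))
∑-upTo-+ zero    n f = sym (ℤ.+-identityˡ _)
∑-upTo-+ (suc m) n f = begin
  ∑ (upTo (suc m ℕ.+ n)) f                         ≡⟨ ∑-upTo-suc (m ℕ.+ n) f ⟩
  f 0 + ∑ (upTo (m ℕ.+ n)) (f ∘ suc)               ≡⟨ cong (_+_ (f 0)) (∑-upTo-+ m n (f ∘ suc)) ⟩
  f 0 + (∑ (upTo m) (f ∘ suc) + tail)              ≡⟨ ℤ.+-assoc (f 0) _ tail ⟨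
  f 0 + ∑ (upTo m) (f ∘ suc) + tail                ≡⟨ cong (_+ tail) (∑-upTo-suc m f) ⟨
  ∑ (upTo (suc m)) f + tail                        ∎
  where tail = ∑ (upTo n) (λ k → f (suc m ℕ.+ k))

∑-telescope : ∀ n (f : ℕ → ℤ) → ∑ (upTo n) (λ k → f (suc k) - f k) ≡ f n - f 0
∑-telescope zero    f = sym (ℤ.+-inverseʳ (f 0))
∑-telescope (suc n) f = begin
  ∑ (upTo (suc n)) (λ k → f (suc k) - f k)       ≡⟨ ∑-upTo-suc n (λ k → f (suc k) - f k) ⟩
  f 1 - f 0 + ∑ (upTo n) (λ k → f (suc (suc k)) - f (suc k)) ≡⟨ cong (_+_ (f 1 - f 0)) (∑-telescope n (f ∘ suc)) ⟩
  f 1 - f 0 + (f (suc n) - f 1)                  ≡⟨ ring (f 1) (f 0) (f (suc n)) ⟩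
  f (suc n) - f 0                                ∎
  where
  ring : ∀ i j k → i - j + (k - i) ≡ k - j
  ring = solve-∀

-- The range splits at `x` and at `x + r + 1`. Below `x` the predicate may well hold, but the
-- argument of `h` is negative there; beyond `x + r` the predicate fails. It serves for a row or
-- column of a subdiagram, with `r` an arm or a leg.
∑-interval : ∀ {P : Pred ℕ ℓ} (P? : Decidable P) (h : ℤ → ℤ) → (∀ k → h -[1+ k ] ≡ + 0) →
  ∀ {n} x r → x ℕ.+ r < n → (∀ s → s ℕ.≤ r → P (x ℕ.+ s)) → (∀ s → P (x ℕ.+ s) → s ℕ.≤ r) →
  ∑ (upTo n) (λ k → 𝟏 (P? k) * h (+ k - + x)) ≡ ∑ (upTo (suc r)) (λ s → h (+ s))
∑-interval {P = P} P? h h≡0 {n} x r x+r<n inside outside = begin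
  ∑ (upTo n) f
    ≡⟨ cong (λ n → ∑ (upTo n) f) (ℕ.m+[n∸m]≡n x≤n) ⟨
  ∑ (upTo (x ℕ.+ (n ℕ.∸ x))) f
    ≡⟨ ∑-upTo-+ x (n ℕ.∸ x) f ⟩
  ∑ (upTo x) f + ∑ (upTo (n ℕ.∸ x)) f₁
    ≡⟨ cong₂ _+_ (trans (∑-upTo-cong x before) (∑-zero (upTo x)))
         (cong (λ n → ∑ (upTo n) f₁) (sym (ℕ.m+[n∸m]≡n r<n∸x))) ⟩
  + 0 + ∑ (upTo (suc r ℕ.+ w)) f₁
    ≡⟨ ℤ.+-identityˡ _ ⟩
  ∑ (upTo (suc r ℕ.+ w)) f₁
    ≡⟨ ∑-upTo-+ (suc r) w f₁ ⟩
  ∑ (upTo (suc r)) f₁ + ∑ (upTo w) (λ k → f₁ (suc r ℕ.+ k))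
    ≡⟨ cong₂ _+_ (∑-upTo-cong (suc r) during)
         (trans (∑-cong (upTo w) after) (∑-zero (upTo w))) ⟩
  ∑ (upTo (suc r)) (λ s → h (+ s)) + + 0
    ≡⟨ ℤ.+-identityʳ _ ⟩
  ∑ (upTo (suc r)) (λ s → h (+ s)) ∎
  where
  f f₁ : ℕ → ℤ
  f k = 𝟏 (P? k) * h (+ k - + x)
  f₁ s = f (x ℕ.+ s)
  x≤n : x ℕ.≤ n
  x≤n = ℕ.≤-trans (ℕ.m≤m+n x r) (ℕ.<⇒≤ x+r<n)
  r<n∸x : r < n ℕ.∸ x
  r<n∸x = ℕ.m+n≤o⇒m≤o∸n (suc r) (subst (λ k → suc k ℕ.≤ n) (ℕ.+-comm x r) x+r<n)
  w = (n ℕ.∸ x) ℕ.∸ suc r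
  before : ∀ k → k < x → f k ≡ + 0
  before k k<x with <⇒-≡-[1+] k<x
  ... | d , eq = trans (cong (λ i → 𝟏 (P? k) * h i) eq)
    (trans (cong (_*_ (𝟏 (P? k))) (h≡0 d)) (ℤ.*-zeroʳ (𝟏 (P? k))))
  cancel : ∀ i j → i + j - i ≡ j
  cancel = solve-∀
  during : ∀ s → s < suc r → f₁ s ≡ h (+ s)
  during s (s≤s s≤r) = trans
    (cong₂ _*_ (𝟏-yes (P? (x ℕ.+ s)) (inside s s≤r)) (cong h (cancel (+ x) (+ s))))
    (ℤ.*-identityˡ _)
  after : ∀ k → f₁ (suc r ℕ.+ k) ≡ + 0
  after k = cong (_* h (+ (x ℕ.+ (suc r ℕ.+ k)) - + x))
    (𝟏-no (P? _) λ p → ℕ.<⇒≱ (ℕ.m≤m+n (suc r) k) (outside _ p))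

-- Rational fractions

-- A quotient `i / n` is stored in lowest terms; on unnormalised fractions equality and order are
-- cross-multiplication, so the arithmetic is carried out there.
toℚᵘ-/ : ∀ i n .{{_ : NonZero n}} → toℚᵘ (i / n) ℚᵘ.≃ i ℚᵘ./ n
toℚᵘ-/ i (suc n) = ℚ.toℚᵘ-fromℚᵘ (ℚᵘ.mkℚᵘ i n)

fromℤ-+ : ∀ i j → fromℤ (i + j) ≡ fromℤ i ℚ.+ fromℤ j
fromℤ-+ i j = ℚ.toℚᵘ-injective (ℚᵘ.≃-trans (toℚᵘ-/ (i + j) 1)
  (ℚᵘ.≃-trans (ℚᵘ.*≡* (ring i j)) (ℚᵘ.≃-trans
    (ℚᵘ.≃-sym (ℚᵘ.+-cong (toℚᵘ-/ i 1) (toℚᵘ-/ j 1)))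
    (ℚᵘ.≃-sym (ℚ.toℚᵘ-homo-+ (fromℤ i) (fromℤ j))))))
  where
  ring : ∀ i j → (i + j) * + 1 ≡ (i * + 1 + j * + 1) * + 1
  ring = solve-∀

fromℤ-* : ∀ i j → fromℤ (i * j) ≡ fromℤ i ℚ.* fromℤ j
fromℤ-* i j = ℚ.toℚᵘ-injective (ℚᵘ.≃-trans (toℚᵘ-/ (i * j) 1)
  (ℚᵘ.≃-trans (ℚᵘ.*≡* refl) (ℚᵘ.≃-trans
    (ℚᵘ.≃-sym (ℚᵘ.*-cong (toℚᵘ-/ i 1) (toℚᵘ-/ j 1)))
    (ℚᵘ.≃-sym (ℚ.toℚᵘ-homo-* (fromℤ i) (fromℤ j))))))

/-<⇒* : ∀ p q r s .{{_ : NonZero q}} .{{_ : NonZero s}} →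
         + p / q ℚ.< + r / s → p ℕ.* s < r ℕ.* q
/-<⇒* p q@(suc _) r s@(suc _) lt
  with ℚᵘ.<-respʳ-≃ (toℚᵘ-/ (+ r) s) (ℚᵘ.<-respˡ-≃ (toℚᵘ-/ (+ p) q) (ℚ.toℚᵘ-mono-< lt))
... | ℚᵘ.*<* ps<rq rewrite sym (ℤ.pos-* p s) | sym (ℤ.pos-* r q) = ℤ.drop‿+<+ ps<rq

*⇒/-< : ∀ p q r s .{{_ : NonZero q}} .{{_ : NonZero s}} →
         p ℕ.* s < r ℕ.* q → + p / q ℚ.< + r / s
*⇒/-< p q@(suc _) r s@(suc _) lt = ℚ.toℚᵘ-cancel-<
  (ℚᵘ.<-respʳ-≃ (ℚᵘ.≃-sym (toℚᵘ-/ (+ r) s)) (ℚᵘ.<-respˡ-≃ (ℚᵘ.≃-sym (toℚᵘ-/ (+ p) q)) (ℚᵘ.*<* lt′)))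
  where
  lt′ : + p * + s ℤ.< + r * + q
  lt′ rewrite sym (ℤ.pos-* p s) | sym (ℤ.pos-* r q) = +<+ lt

-- Cell weights and their mixed differences

module _ (a b : ℕ) where

  -- Twice the even part of `K`: exchanging the two summation indices in `B` pairs the value at `d`
  -- with the value at `- d`.
  Kˢ : ℤ → ℤ
  Kˢ d = K a b d + K a b (- d)

  Kˢ-neg : ∀ d → Kˢ (- d) ≡ Kˢ d
  Kˢ-neg d = trans (cong (λ e → K a b (- d) + K a b e) (ℤ.neg-involutive d))
    (ℤ.+-comm (K a b (- d)) (K a b d))

  -- The indicator of -a < d < b, written so that its mixed difference is visibly Kˢ.
  N : ℤ → ℤ
  N d = + 1 - 𝟏 (+ a ≤? - d) - 𝟏 (+ b ≤? d)

  -- Shifting `d` by `- a` or by `b` moves the thresholds of `N` among `0`, `a`, `b` and `a + b`.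
  -- The four values of `N` contain each of the eight indicators of `Kˢ` exactly once, and the
  -- constants cancel.
  Kˢ≡ΔΔN : ∀ d → Kˢ d ≡ (N d - N (d - + a)) - (N (d + + b) - N (d - + a + + b))
  Kˢ≡ΔΔN d = begin
    Kˢ d
      ≡⟨ ring p₀ pₐ p_b p_c q₀ qₐ q_b q_c ⟩
    ((+ 1 - qₐ - p_b) - (+ 1 - q₀ - p_c)) - ((+ 1 - q_c - p₀) - (+ 1 - q_b - pₐ))
      ≡⟨ cong₂ _-_ (cong (_-_ (N d)) N₁) (cong₂ _-_ N₂ N₃) ⟨
    (N d - N (d - + a)) - (N (d + + b) - N (d - + a + + b)) ∎
    where
    c : ℕ
    c = a ℕ.+ b
    p₀ pₐ p_b p_c q₀ qₐ q_b q_c : ℤ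
    p₀  = 𝟏 (+ 0 ≤? d)
    pₐ  = 𝟏 (+ a ≤? d)
    p_b = 𝟏 (+ b ≤? d)
    p_c = 𝟏 (+ c ≤? d)
    q₀  = 𝟏 (+ 0 ≤? - d)
    qₐ  = 𝟏 (+ a ≤? - d)
    q_b = 𝟏 (+ b ≤? - d)
    q_c = 𝟏 (+ c ≤? - d)
    ring : ∀ p₀ pₐ p_b p_c q₀ qₐ q_b q_c →
      (p₀ - pₐ - p_b + p_c) + (q₀ - qₐ - q_b + q_c) ≡
      ((+ 1 - qₐ - p_b) - (+ 1 - q₀ - p_c)) - ((+ 1 - q_c - p₀) - (+ 1 - q_b - pₐ))
    ring = solve-∀
    N-cong : ∀ e {p q} → 𝟏 (+ a ≤? - e) ≡ q → 𝟏 (+ b ≤? e) ≡ p → N e ≡ + 1 - q - p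
    N-cong e = cong₂ (λ q p → + 1 - q - p)
    r₁ : ∀ a d → - (d - a) - a ≡ - d - + 0
    r₁ = solve-∀
    r₂ : ∀ a b d → d - a - b ≡ d - (a + b)
    r₂ = solve-∀
    r₃ : ∀ a b d → - (d + b) - a ≡ - d - (a + b)
    r₃ = solve-∀
    r₄ : ∀ b d → d + b - b ≡ d - + 0
    r₄ = solve-∀
    r₅ : ∀ a b d → - (d - a + b) - a ≡ - d - b
    r₅ = solve-∀
    r₆ : ∀ a b d → d - a + b - b ≡ d - a
    r₆ = solve-∀
    N₁ : N (d - + a) ≡ + 1 - q₀ - p_c
    N₁ = N-cong (d - + a) (𝟏-≤-cong (+ a) (- (d - + a)) (+ 0) (- d) (r₁ (+ a) d))
                          (𝟏-≤-cong (+ b) (d - + a) (+ c) d (r₂ (+ a) (+ b) d))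
    N₂ : N (d + + b) ≡ + 1 - q_c - p₀
    N₂ = N-cong (d + + b) (𝟏-≤-cong (+ a) (- (d + + b)) (+ c) (- d) (r₃ (+ a) (+ b) d))
                          (𝟏-≤-cong (+ b) (d + + b) (+ 0) d (r₄ (+ b) d))
    N₃ : N (d - + a + + b) ≡ + 1 - q_b - pₐ
    N₃ = N-cong (d - + a + + b) (𝟏-≤-cong (+ a) (- (d - + a + + b)) (+ b) (- d) (r₅ (+ a) (+ b) d))
                                (𝟏-≤-cong (+ b) (d - + a + + b) (+ a) d (r₆ (+ a) (+ b) d))

  -- C (arm + 1) (leg + 1) is the contribution of a cell to the cross-dinv; a
  -- zero argument stands for arm = -1 or leg = -1.
  C : ℕ → ℕ → ℤ
  C (suc r) (suc l) = N (+ a * + r - + b * + l)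
  C _       _       = + 0

  C-zeroʳ : ∀ r → C r 0 ≡ + 0
  C-zeroʳ zero    = refl
  C-zeroʳ (suc _) = refl

  κ : ℕ → ℕ → ℤ
  κ s u = (C (suc s) (suc u) - C s (suc u)) - (C (suc s) u - C s u)

  -- Telescoping first in `u`, then in `s`; the boundary terms are values of `C` with a zero
  -- argument.
  ∑∑κ : ∀ r l → ∑ (upTo r) (λ s → ∑ (upTo l) (κ s)) ≡ C r l
  ∑∑κ r l = begin
    ∑ (upTo r) (λ s → ∑ (upTo l) (κ s))         ≡⟨ ∑-cong (upTo r) row ⟩
    ∑ (upTo r) (λ s → C (suc s) l - C s l)      ≡⟨ ∑-telescope r (λ s → C s l) ⟩
    C r l + + 0                                 ≡⟨ ℤ.+-identityʳ (C r l) ⟩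
    C r l                                       ∎
    where
    row : ∀ s → ∑ (upTo l) (κ s) ≡ C (suc s) l - C s l
    row s = begin
      ∑ (upTo l) (κ s)                ≡⟨ ∑-telescope l (λ u → C (suc s) u - C s u) ⟩
      C (suc s) l - C s l - (+ 0 - C s 0) ≡⟨ cong (λ z → C (suc s) l - C s l - (+ 0 - z)) (C-zeroʳ s) ⟩
      C (suc s) l - C s l + + 0       ≡⟨ ℤ.+-identityʳ _ ⟩
      C (suc s) l - C s l             ∎

  -- Extension by zero from the closed quadrant of displacements, so that sums may run over all
  -- pairs of cells whatever their relative position.
  κℤ : ℤ → ℤ → ℤ
  κℤ (+ s) (+ u) = κ s u
  κℤ _     _     = + 0

  κℤ-negʳ : ∀ p u → κℤ p -[1+ u ] ≡ + 0
  κℤ-negʳ (+ _)    u = refl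
  κℤ-negʳ -[1+ _ ] u = refl

  κℤ-negˡ : ∀ s v → κℤ -[1+ s ] v ≡ + 0
  κℤ-negˡ s (+ _)    = refl
  κℤ-negˡ s -[1+ _ ] = refl

  module _ (0<a : 0 < a) (0<b : 0 < b) where

    -- Adding the two inequalities would give `a + b ≤ 0`. Hence `N` never subtracts both of its
    -- indicators and takes only the values 0 and 1.
    exclusive : ∀ {d} → + a ≤ - d → ¬ + b ≤ d
    exclusive {d} a≤-d b≤d = ℕ.<⇒≱ (ℕ.+-mono-≤ 0<a (ℕ.z≤n {b}))
      (ℤ.drop‿+≤+ (subst (+ (a ℕ.+ b) ≤_) (ℤ.+-inverseˡ d) (ℤ.+-mono-≤ a≤-d b≤d)))

    N≡0-above : ∀ {d} → + b ≤ d → N d ≡ + 0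
    N≡0-above {d} b≤d rewrite 𝟏-yes (+ b ≤? d) b≤d
      | 𝟏-no (+ a ≤? - d) (λ a≤-d → exclusive a≤-d b≤d) = refl

    N≡0-below : ∀ {d} → + a ≤ - d → N d ≡ + 0
    N≡0-below {d} a≤-d rewrite 𝟏-yes (+ a ≤? - d) a≤-d
      | 𝟏-no (+ b ≤? d) (exclusive a≤-d) = refl

    N≡1 : ∀ {d} → ¬ + a ≤ - d → ¬ + b ≤ d → N d ≡ + 1
    N≡1 {d} a≰-d b≰d rewrite 𝟏-no (+ a ≤? - d) a≰-d | 𝟏-no (+ b ≤? d) b≰d = refl

    private
      δ : ℕ → ℕ → ℤ
      δ s u = + a * + s - + b * + u

    -- At `s = 0` the convention for arm -1 agrees with `N`: the argument is `- b u - a`, which is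
    -- at most `- a`.
    C-west : ∀ s u → C s (suc u) ≡ N (δ s u - + a)
    C-west (suc s) u = cong N (ring (+ a) (+ s) (+ b * + u))
      where
      ring : ∀ a s v → a * s - v ≡ a * (+ 1 + s) - v - a
      ring = solve-∀
    C-west zero u = sym (N≡0-below {δ zero u - + a} (j-i≡+⇒i≤j (b ℕ.* u)
      (trans (ring (+ a) (+ b) (+ u)) (sym (ℤ.pos-* b u)))))
      where
      ring : ∀ a b u → - (a * + 0 - b * u - a) - a ≡ b * u
      ring = solve-∀

    -- At `u = 0` the convention for leg -1 agrees with `N`: the argument is `a s + b`, which is at
    -- least `b`.
    C-south : ∀ s u → C (suc s) u ≡ N (δ s u + + b)
    C-south s (suc u) = cong N (ring (+ b) (+ u) (+ a * + s))
      where
      ring : ∀ b u v → v - b * u ≡ v - b * (+ 1 + u) + b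
      ring = solve-∀
    C-south s zero = sym (N≡0-above {δ s zero + + b} (j-i≡+⇒i≤j (a ℕ.* s)
      (trans (ring (+ a) (+ b) (+ s)) (sym (ℤ.pos-* a s)))))
      where
      ring : ∀ a b s → a * s - b * + 0 + b - b ≡ a * s
      ring = solve-∀

    -- The origin is a genuine exception: there `C 0 0` is 0, while `N` at `b - a` is 1. This is why
    -- `κ 0 0` is 1 although `Kˢ` at 0 is 2.
    C-southwest : ∀ s u → ¬ (s ≡ 0 × u ≡ 0) → C s u ≡ N (δ s u - + a + + b)
    C-southwest zero zero ≢0 = contradiction (refl , refl) ≢0
    C-southwest (suc s) u _ = trans (C-south s u) (cong N (ring (+ a) (+ s) (+ b) (+ b * + u)))
      where
      ring : ∀ a s b v → a * s - v + b ≡ a * (+ 1 + s) - v - a + b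
      ring = solve-∀
    C-southwest zero (suc u) _ = trans (C-west zero u) (cong N (ring (+ a) (+ b) (+ u)))
      where
      ring : ∀ a b u → a * + 0 - b * u - a ≡ a * + 0 - b * (+ 1 + u) - a + b
      ring = solve-∀

    κ≡Kˢ : ∀ s u → ¬ (s ≡ 0 × u ≡ 0) → κ s u ≡ Kˢ (δ s u)
    κ≡Kˢ s u ≢0 = trans
      (cong₂ _-_ (cong (_-_ (N (δ s u))) (C-west s u))
                 (cong₂ _-_ (C-south s u) (C-southwest s u ≢0)))
      (sym (Kˢ≡ΔΔN (δ s u)))

    Kˢ-0 : Kˢ (+ 0) ≡ + 2
    Kˢ-0 rewrite 𝟏-no (+ a ≤? + 0) (ℕ.<⇒≱ 0<a ∘ ℤ.drop‿+≤+)
               | 𝟏-no (+ b ≤? + 0) (ℕ.<⇒≱ 0<b ∘ ℤ.drop‿+≤+)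
               | 𝟏-no (+ (a ℕ.+ b) ≤? + 0) (ℕ.<⇒≱ (ℕ.+-mono-≤ 0<a (ℕ.z≤n {b})) ∘ ℤ.drop‿+≤+) = refl

    κ-0-0 : κ 0 0 ≡ + 1
    κ-0-0 = cong (λ z → z - + 0 - + 0) C≡1
      where
      ring : ∀ a b → a * + 0 - b * + 0 ≡ + 0
      ring = solve-∀
      C≡1 : C 1 1 ≡ + 1
      C≡1 = trans (cong N (ring (+ a) (+ b)))
        (N≡1 (ℕ.<⇒≱ 0<a ∘ ℤ.drop‿+≤+) (ℕ.<⇒≱ 0<b ∘ ℤ.drop‿+≤+))

    K-neg : ∀ d → ¬ + 0 ≤ d → K a b d ≡ + 0
    K-neg d 0≰d
      rewrite 𝟏-no (+ 0 ≤? d) 0≰d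
            | 𝟏-no (+ a ≤? d) (0≰d ∘ ℤ.≤-trans (+≤+ z≤n))
            | 𝟏-no (+ b ≤? d) (0≰d ∘ ℤ.≤-trans (+≤+ z≤n))
            | 𝟏-no (+ (a ℕ.+ b) ≤? d) (0≰d ∘ ℤ.≤-trans (+≤+ z≤n)) = refl

    K-far : ∀ d → + (a ℕ.+ b) ≤ d → K a b d ≡ + 0
    K-far d a+b≤d
      rewrite 𝟏-yes (+ 0 ≤? d) (ℤ.≤-trans (+≤+ z≤n) a+b≤d)
            | 𝟏-yes (+ a ≤? d) (ℤ.≤-trans (+≤+ (ℕ.m≤m+n a b)) a+b≤d)
            | 𝟏-yes (+ b ≤? d) (ℤ.≤-trans (+≤+ (ℕ.m≤n+m b a)) a+b≤d)
            | 𝟏-yes (+ (a ℕ.+ b) ≤? d) a+b≤d = refl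

    Kˢ-far : ∀ d → + (a ℕ.+ b) ≤ d → Kˢ d ≡ + 0
    Kˢ-far d a+b≤d = cong₂ _+_ (K-far d a+b≤d) (K-neg (- d) λ 0≤-d →
      ℕ.<⇒≱ (ℕ.+-mono-≤ 0<a (ℕ.z≤n {b})) (ℤ.drop‿+≤+
        (subst (+ (a ℕ.+ b) ≤_) (ℤ.+-inverseˡ d) (ℤ.+-mono-≤ 0≤-d a+b≤d))))

    Kˢ-same-side : ∀ s u → Kˢ (+ a * + suc s + + b * + suc u) ≡ + 0
    Kˢ-same-side s u = Kˢ-far (+ a * + suc s + + b * + suc u) (j-i≡+⇒i≤j (a ℕ.* s ℕ.+ b ℕ.* u)
      (trans (ring (+ a) (+ s) (+ b) (+ u)) (cong₂ _+_ (sym (ℤ.pos-* a s)) (sym (ℤ.pos-* b u)))))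
      where
      ring : ∀ a s b u → a * (+ 1 + s) + b * (+ 1 + u) - (a + b) ≡ a * s + b * u
      ring = solve-∀

    -- By the signs of `p` and `q`. Away from the origin at most one of the two closed quadrants
    -- contains the displacement, and evenness of `Kˢ` reduces the negative quadrant to the positive
    -- one. Strictly opposite signs lie in neither quadrant, and `Kˢ` vanishes. The origin lies in
    -- both, which accounts for 2 = 1 + 1.
    Kˢ≡κℤ+κℤ : ∀ p q → Kˢ (+ a * p - + b * q) ≡ κℤ p q + κℤ (- p) (- q)
    Kˢ≡κℤ+κℤ (+ zero) (+ zero) = begin
      Kˢ (+ a * + 0 - + b * + 0) ≡⟨ cong Kˢ (ring (+ a) (+ b)) ⟩
      Kˢ (+ 0)                   ≡⟨ Kˢ-0 ⟩
      + 2                        ≡⟨ cong₂ _+_ κ-0-0 κ-0-0 ⟨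
      κ 0 0 + κ 0 0              ∎
      where
      ring : ∀ a b → a * + 0 - b * + 0 ≡ + 0
      ring = solve-∀
    Kˢ≡κℤ+κℤ (+ zero) (+ suc u) = trans (sym (κ≡Kˢ 0 (suc u) λ ())) (sym (ℤ.+-identityʳ _))
    Kˢ≡κℤ+κℤ (+ suc s) (+ u) = trans (sym (κ≡Kˢ (suc s) u λ ()))
      (sym (trans (cong (_+_ (κ (suc s) u)) (κℤ-negˡ s (- + u))) (ℤ.+-identityʳ _)))
    Kˢ≡κℤ+κℤ (+ suc s) -[1+ u ] = trans (cong Kˢ (ring (+ a) (+ suc s) (+ b) (+ suc u)))
      (Kˢ-same-side s u)
      where
      ring : ∀ a s b u → a * s - b * (- u) ≡ a * s + b * u
      ring = solve-∀
    Kˢ≡κℤ+κℤ (+ zero) -[1+ u ] = begin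
      Kˢ (+ a * + 0 - + b * -[1+ u ])    ≡⟨ cong Kˢ (ring (+ a) (+ b) (+ suc u)) ⟩
      Kˢ (- (+ a * + 0 - + b * + suc u)) ≡⟨ Kˢ-neg (+ a * + 0 - + b * + suc u) ⟩
      Kˢ (+ a * + 0 - + b * + suc u)     ≡⟨ κ≡Kˢ 0 (suc u) (λ ()) ⟨
      κ 0 (suc u)                        ≡⟨ ℤ.+-identityˡ _ ⟨
      + 0 + κ 0 (suc u)                  ∎
      where
      ring : ∀ a b u → a * + 0 - b * (- u) ≡ - (a * + 0 - b * u)
      ring = solve-∀
    Kˢ≡κℤ+κℤ -[1+ s ] (+ suc u) = begin
      Kˢ (+ a * -[1+ s ] - + b * + suc u)    ≡⟨ cong Kˢ (ring (+ a) (+ suc s) (+ b) (+ suc u)) ⟩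
      Kˢ (- (+ a * + suc s + + b * + suc u)) ≡⟨ Kˢ-neg (+ a * + suc s + + b * + suc u) ⟩
      Kˢ (+ a * + suc s + + b * + suc u)     ≡⟨ Kˢ-same-side s u ⟩
      + 0                                    ∎
      where
      ring : ∀ a s b u → a * (- s) - b * u ≡ - (a * s + b * u)
      ring = solve-∀
    Kˢ≡κℤ+κℤ -[1+ s ] (+ zero) = begin
      Kˢ (+ a * -[1+ s ] - + b * + 0)    ≡⟨ cong Kˢ (ring (+ a) (+ suc s) (+ b)) ⟩
      Kˢ (- (+ a * + suc s - + b * + 0)) ≡⟨ Kˢ-neg (+ a * + suc s - + b * + 0) ⟩
      Kˢ (+ a * + suc s - + b * + 0)     ≡⟨ κ≡Kˢ (suc s) 0 (λ ()) ⟨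
      κ (suc s) 0                        ≡⟨ ℤ.+-identityˡ _ ⟨
      + 0 + κ (suc s) 0                  ∎
      where
      ring : ∀ a s b → a * (- s) - b * + 0 ≡ - (a * s - b * + 0)
      ring = solve-∀
    Kˢ≡κℤ+κℤ -[1+ s ] -[1+ u ] = begin
      Kˢ (+ a * -[1+ s ] - + b * -[1+ u ])   ≡⟨ cong Kˢ (ring (+ a) (+ suc s) (+ b) (+ suc u)) ⟩
      Kˢ (- (+ a * + suc s - + b * + suc u)) ≡⟨ Kˢ-neg (+ a * + suc s - + b * + suc u) ⟩
      Kˢ (+ a * + suc s - + b * + suc u)     ≡⟨ κ≡Kˢ (suc s) (suc u) (λ ()) ⟨
      κ (suc s) (suc u)                      ≡⟨ ℤ.+-identityˡ _ ⟨
      + 0 + κ (suc s) (suc u)                ∎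
      where
      ring : ∀ a s b u → a * (- s) - b * (- u) ≡ - (a * s - b * u)
      ring = solve-∀

-- Counting by pairs

module _ {a b : ℕ} where

  open Subdiagram

  g-antitone : ∀ {x y x′ y′} → x ≤ x′ → y ≤ y′ → g a b (x′ , y′) ≤ g a b (x , y)
  g-antitone x≤x′ y≤y′ = ℤ.+-mono-≤
    (ℤ.+-monoʳ-≤ (+ a * + b) (ℤ.neg-mono-≤ (ℤ.*-monoˡ-≤-nonNeg (+ a) x≤x′)))
    (ℤ.neg-mono-≤ (ℤ.*-monoˡ-≤-nonNeg (+ b) y≤y′))

  -- Since `g` does not decrease towards the south-west, positive coordinates alone put the smaller
  -- cell in `G`.
  ∈ᴰ-downward : ∀ (D : Subdiagram a b) {x y x′ y′} → (x′ , y′) ∈ᴰ D →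
                + 1 ≤ x → + 1 ≤ y → x ≤ x′ → y ≤ y′ → (x , y) ∈ᴰ D
  ∈ᴰ-downward D c′∈D 1≤x 1≤y x≤x′ y≤y′ = closed D c′∈D
    (1≤x , 1≤y , ℤ.<-≤-trans (proj₂ (proj₂ (Mem⊆G D c′∈D))) (g-antitone x≤x′ y≤y′)) x≤x′ y≤y′

  -- The corner shares its `x` with the cell of `E` and its `y` with the cell of `D`, so its
  -- coordinates are positive and downward closure applies twice.
  ∈ᴰ-corner : ∀ (D E : Subdiagram a b) {x y x′ y′} → (x′ , y) ∈ᴰ D → (x , y′) ∈ᴰ E →
              x ≤ x′ → y ≤ y′ → (x , y) ∈ᴰ D × (x , y) ∈ᴰ E
  ∈ᴰ-corner D E c∈D c∈E x≤x′ y≤y′ =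
    ∈ᴰ-downward D c∈D 1≤x 1≤y x≤x′ ℤ.≤-refl , ∈ᴰ-downward E c∈E 1≤x 1≤y ℤ.≤-refl y≤y′
    where
    1≤x = proj₁ (Mem⊆G E c∈E)
    1≤y = proj₁ (proj₂ (Mem⊆G D c∈D))

  χ : Subdiagram a b → Cell → ℤ
  χ D c = 𝟏 (c ∈ᴰ? D)

  χ-∉G : ∀ D {c} → ¬ G a b c → χ D c ≡ + 0
  χ-∉G D {c} c∉G = 𝟏-no (c ∈ᴰ? D) (c∉G ∘ Mem⊆G D)

  -- Eastward from a cell of `D`, its row meets `D` in an interval of arm + 1 cells.
  arm-sum : ∀ D {x y} → (+ x , + y) ∈ᴰ D → (h : ℤ → ℤ) → (∀ k → h -[1+ k ] ≡ + 0) →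
            ∑ (upTo b) (λ k → χ D (+ k , + y) * h (+ k - + x)) ≡
            ∑ (upTo (suc (arm D (+ x , + y)))) (λ s → h (+ s))
  arm-sum D {x} {y} c∈D h h≡0 = ∑-interval (λ k → (+ k , + y) ∈ᴰ? D) h h≡0 x (arm D (+ x , + y))
    x+arm<b
    (λ s s≤arm → ∈ᴰ-downward D (arm-∈ D c∈D) (ℤ.≤-trans 1≤x (+≤+ (ℕ.m≤m+n x s))) 1≤y
                   (+≤+ (ℕ.+-monoʳ-≤ x s≤arm)) ℤ.≤-refl)
    (λ s → arm-max D c∈D)
    where
    1≤x = proj₁ (Mem⊆G D c∈D)
    1≤y = proj₁ (proj₂ (Mem⊆G D c∈D))
    x+arm<b : x ℕ.+ arm D (+ x , + y) < b
    x+arm<b with G-bounded a b (Mem⊆G D (arm-∈ D c∈D))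
    ... | _ , _ , eq , lt , _ = subst (_< b) (sym (ℤ.+-injective (cong proj₁ eq))) lt

  leg-sum : ∀ D {x y} → (+ x , + y) ∈ᴰ D → (h : ℤ → ℤ) → (∀ k → h -[1+ k ] ≡ + 0) →
            ∑ (upTo a) (λ k → χ D (+ x , + k) * h (+ k - + y)) ≡
            ∑ (upTo (suc (leg D (+ x , + y)))) (λ u → h (+ u))
  leg-sum D {x} {y} c∈D h h≡0 = ∑-interval (λ k → (+ x , + k) ∈ᴰ? D) h h≡0 y (leg D (+ x , + y))
    y+leg<a
    (λ u u≤leg → ∈ᴰ-downward D (leg-∈ D c∈D) 1≤x (ℤ.≤-trans 1≤y (+≤+ (ℕ.m≤m+n y u)))
                   ℤ.≤-refl (+≤+ (ℕ.+-monoʳ-≤ y u≤leg)))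
    (λ u → leg-max D c∈D)
    where
    1≤x = proj₁ (Mem⊆G D c∈D)
    1≤y = proj₁ (proj₂ (Mem⊆G D c∈D))
    y+leg<a : y ℕ.+ leg D (+ x , + y) < a
    y+leg<a with G-bounded a b (Mem⊆G D (leg-∈ D c∈D))
    ... | _ , _ , eq , _ , lt = subst (_< a) (sym (ℤ.+-injective (cong proj₂ eq))) lt

  ∑-box : ∀ f → ∑ (box a b) f ≡ ∑ (upTo b) (λ x → ∑ (upTo a) (λ y → f (+ x , + y)))
  ∑-box f = trans (∑-product (map +_ (upTo b)) (map +_ (upTo a)) f)
    (trans (∑-map +_ (upTo b) (λ x → ∑ (map +_ (upTo a)) (λ y → f (x , y))))
      (∑-cong (upTo b) λ x → ∑-map +_ (upTo a) (λ y → f (+ x , y))))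

  -- In the box, unlike in `G`, the two coordinates range independently, so their sums can be
  -- exchanged one at a time.
  ∑-cellsG : ∀ f → (∀ c → ¬ G a b c → f c ≡ + 0) →
             ∑ (cellsG a b) f ≡ ∑ (upTo b) (λ x → ∑ (upTo a) (λ y → f (+ x , + y)))
  ∑-cellsG f f≡0 = trans (∑-filter (G? a b) (box a b) f f≡0) (∑-box f)

  ∑² : (Cell → Cell → ℤ) → ℤ
  ∑² f = ∑ (cellsG a b) (λ i → ∑ (cellsG a b) (f i))

  ∑²-cong : ∀ {f h} → (∀ i j → f i j ≡ h i j) → ∑² f ≡ ∑² h
  ∑²-cong eq = ∑-cong (cellsG a b) λ i → ∑-cong (cellsG a b) (eq i)

  ∑²-+ : ∀ f h → ∑² (λ i j → f i j + h i j) ≡ ∑² f + ∑² h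
  ∑²-+ f h = trans (∑-cong (cellsG a b) λ i → ∑-+ (cellsG a b) (f i) (h i))
    (∑-+ (cellsG a b) (λ i → ∑ (cellsG a b) (f i)) (λ i → ∑ (cellsG a b) (h i)))

  ∑²-swap : ∀ f → ∑² f ≡ ∑² (λ i j → f j i)
  ∑²-swap = ∑-swap (cellsG a b) (cellsG a b)

  -- With corner `(x′ , y)`, the arguments of `κℤ` are the eastward distance from the corner to `i`
  -- and the northward distance from it to `j`.
  pairWeight : Subdiagram a b → Subdiagram a b → Cell → Cell → ℤ
  pairWeight D E i@(x , y) j@(x′ , y′) = χ D i * χ E j * κℤ a b (x - x′) (y′ - y)

  pairWeight-≡0 : ∀ D E x y x′ y′ → ¬ ((+ x′ , + y) ∈ᴰ D × (+ x′ , + y) ∈ᴰ E) →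
                  pairWeight D E (+ x , + y) (+ x′ , + y′) ≡ + 0
  pairWeight-≡0 D E x y x′ y′ ∉D∩E = by-cases
    (x′ ℕ.≤? x) (y ℕ.≤? y′) ((+ x , + y) ∈ᴰ? D) ((+ x′ , + y′) ∈ᴰ? E)
    where
    χχ p q : ℤ
    χχ = χ D (+ x , + y) * χ E (+ x′ , + y′)
    p = + x - + x′
    q = + y′ - + y
    by-cases : Dec (x′ ℕ.≤ x) → Dec (y ℕ.≤ y′) →
               Dec ((+ x , + y) ∈ᴰ D) → Dec ((+ x′ , + y′) ∈ᴰ E) → χχ * κℤ a b p q ≡ + 0
    by-cases (no x′≰x) _ _ _ =
      let d , p≡ = <⇒-≡-[1+] (ℕ.≰⇒> x′≰x) in
      *-zeroʳ-≡ χχ (trans (cong (λ p → κℤ a b p q) p≡) (κℤ-negˡ a b d q))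
    by-cases (yes _) (no y≰y′) _ _ =
      let d , q≡ = <⇒-≡-[1+] (ℕ.≰⇒> y≰y′) in
      *-zeroʳ-≡ χχ (trans (cong (κℤ a b p) q≡) (κℤ-negʳ a b p d))
    by-cases (yes x′≤x) (yes y≤y′) (yes c∈D) (yes c∈E) =
      contradiction (∈ᴰ-corner D E c∈D c∈E (+≤+ x′≤x) (+≤+ y≤y′)) ∉D∩E
    by-cases _ _ (no c∉D) _ = *-zeroˡ-≡ (κℤ a b p q)
      (*-zeroˡ-≡ (χ E (+ x′ , + y′)) (𝟏-no ((+ x , + y) ∈ᴰ? D) c∉D))
    by-cases _ _ (yes _) (no c∉E) = *-zeroˡ-≡ (κℤ a b p q)
      (*-zeroʳ-≡ (χ D (+ x , + y)) (𝟏-no ((+ x′ , + y′) ∈ᴰ? E) c∉E))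

  module _ .{{_ : NonZero b}} (0<a : 0 < a) (0<b : 0 < b) where

    -- For arm 0 the upper slope is infinite and the cross-multiplied inequality is `0 < suc l * b`,
    -- which also holds; one integer inequality thus covers both cases.
    <⁺⇒< : ∀ l r → [ + a / b ] <⁺ (suc l /⁺ r) → a ℕ.* r < suc l ℕ.* b
    <⁺⇒< l zero    _  = subst (_< suc l ℕ.* b) (sym (ℕ.*-zeroʳ a)) (ℕ.≤-trans 0<b (ℕ.m≤m+n b _))
    <⁺⇒< l (suc r) lt = /-<⇒* a b (suc l) (suc r) ([<]-injective lt)

    <⇒<⁺ : ∀ l r → a ℕ.* r < suc l ℕ.* b → [ + a / b ] <⁺ (suc l /⁺ r)
    <⇒<⁺ l zero    _  = [ _ ]<⊤⁺
    <⇒<⁺ l (suc r) lt = [ *⇒/-< a b (suc l) (suc r) lt ]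

    -- Clearing denominators, `a ≤ - δ` becomes `a * suc r ≤ l * b`, the failure of the lower slope
    -- condition, and `b ≤ δ` becomes `suc l * b ≤ a * r`, the failure of the upper one.
    N-counted : ∀ (D E : Subdiagram a b) {c} → c ∈ᴰ D → c ∈ᴰ E →
                N a b (+ a * + arm D c - + b * + leg E c) ≡ 𝟏 (counted? D E c)
    N-counted D E {c} c∈D c∈E = by-cases (l ℕ.* b ℕ.<? a ℕ.* suc r) (a ℕ.* r ℕ.<? suc l ℕ.* b)
      where
      r l : ℕ
      r = arm D c
      l = leg E c
      δ : ℤ
      δ = + a * + r - + b * + l
      below : - δ - + a ≡ + (l ℕ.* b) - + (a ℕ.* suc r)
      below = trans (ring (+ a) (+ b) (+ r) (+ l))
                    (cong₂ _-_ (sym (ℤ.pos-* l b)) (sym (ℤ.pos-* a (suc r))))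
        where
        ring : ∀ a b r l → - (a * r - b * l) - a ≡ l * b - a * (+ 1 + r)
        ring = solve-∀
      above : δ - + b ≡ + (a ℕ.* r) - + (suc l ℕ.* b)
      above = trans (ring (+ a) (+ b) (+ r) (+ l))
                    (cong₂ _-_ (sym (ℤ.pos-* a r)) (sym (ℤ.pos-* (suc l) b)))
        where
        ring : ∀ a b r l → a * r - b * l - b ≡ a * r - (+ 1 + l) * b
        ring = solve-∀
      by-cases : Dec (l ℕ.* b < a ℕ.* suc r) → Dec (a ℕ.* r < suc l ℕ.* b) →
                 N a b δ ≡ 𝟏 (counted? D E c)
      by-cases (no m≮) _ = trans
        (N≡0-below a b 0<a 0<b {δ} (≤-resp-diff (sym below) (+≤+ (ℕ.≮⇒≥ m≮))))
        (sym (𝟏-no (counted? D E c) λ (_ , m< , _) → m≮ (/-<⇒* l (suc r) a b m<)))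
      by-cases (yes _) (no ≮M) = trans
        (N≡0-above a b 0<a 0<b {δ} (≤-resp-diff (sym above) (+≤+ (ℕ.≮⇒≥ ≮M))))
        (sym (𝟏-no (counted? D E c) λ (_ , _ , <M) → ≮M (<⁺⇒< l r <M)))
      by-cases (yes m<) (yes <M) = trans
        (N≡1 a b 0<a 0<b {δ} (ℕ.<⇒≱ m< ∘ ℤ.drop‿+≤+ ∘ ≤-resp-diff below)
                             (ℕ.<⇒≱ <M ∘ ℤ.drop‿+≤+ ∘ ≤-resp-diff above))
        (sym (𝟏-yes (counted? D E c)
          ((c∈D , c∈E) , *⇒/-< l (suc r) a b m< , <⇒<⁺ l r <M)))

    -- The sum runs over the pairs with corner `(x , y)`. If the corner lies in both diagrams, the
    -- inner sum is cut down to the leg and the outer one to the arm, and `∑∑κ` evaluates the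
    -- result; otherwise every term vanishes.
    pairWeight-fibre : ∀ (D E : Subdiagram a b) x y →
      ∑ (upTo b) (λ k → ∑ (upTo a) (λ v → pairWeight D E (+ k , + y) (+ x , + v))) ≡
      𝟏 (counted? D E (+ x , + y))
    pairWeight-fibre D E x y = by-cases (((+ x , + y) ∈ᴰ? D) ×-dec ((+ x , + y) ∈ᴰ? E))
      where
      c : Cell
      c = + x , + y
      h : ℤ → ℤ
      h p = ∑ (upTo (suc (leg E c))) (λ u → κℤ a b p (+ u))
      lhs : ℤ
      lhs = ∑ (upTo b) (λ k → ∑ (upTo a) (λ v → pairWeight D E (+ k , + y) (+ x , + v)))
      row : c ∈ᴰ E → ∀ k → ∑ (upTo a) (λ v → pairWeight D E (+ k , + y) (+ x , + v)) ≡
                            χ D (+ k , + y) * h (+ k - + x)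
      row c∈E k = begin
        ∑ (upTo a) (λ v → χD * χ E (+ x , + v) * κℤ a b p (+ v - + y))
          ≡⟨ ∑-cong (upTo a) (λ v → ℤ.*-assoc χD (χ E (+ x , + v)) (κℤ a b p (+ v - + y))) ⟩
        ∑ (upTo a) (λ v → χD * (χ E (+ x , + v) * κℤ a b p (+ v - + y)))
          ≡⟨ ∑-*ˡ (upTo a) χD (λ v → χ E (+ x , + v) * κℤ a b p (+ v - + y)) ⟨
        χD * ∑ (upTo a) (λ v → χ E (+ x , + v) * κℤ a b p (+ v - + y))
          ≡⟨ cong (_*_ χD) (leg-sum E c∈E (κℤ a b p) (κℤ-negʳ a b p)) ⟩
        χD * h p ∎
        where
        χD p : ℤ
        χD = χ D (+ k , + y)
        p = + k - + x
      by-cases : Dec (c ∈ᴰ D × c ∈ᴰ E) → lhs ≡ 𝟏 (counted? D E c)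
      by-cases (no c∉D∩E) = begin
        lhs
          ≡⟨ ∑-cong (upTo b) (λ k → trans
               (∑-cong (upTo a) λ v → pairWeight-≡0 D E k y x v c∉D∩E) (∑-zero (upTo a))) ⟩
        ∑ (upTo b) (λ _ → + 0)   ≡⟨ ∑-zero (upTo b) ⟩
        + 0                      ≡⟨ 𝟏-no (counted? D E c) (c∉D∩E ∘ proj₁) ⟨
        𝟏 (counted? D E c)       ∎
      by-cases (yes (c∈D , c∈E)) = begin
        lhs
          ≡⟨ ∑-cong (upTo b) (row c∈E) ⟩
        ∑ (upTo b) (λ k → χ D (+ k , + y) * h (+ k - + x))
          ≡⟨ arm-sum D c∈D h (λ k → trans (∑-cong (upTo (suc (leg E c))) λ u → κℤ-negˡ a b k (+ u))
                                             (∑-zero (upTo (suc (leg E c))))) ⟩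
        ∑ (upTo (suc (arm D c))) (λ s → ∑ (upTo (suc (leg E c))) (κ a b s))
          ≡⟨ ∑∑κ a b (suc (arm D c)) (suc (leg E c)) ⟩
        C a b (suc (arm D c)) (suc (leg E c))
          ≡⟨ N-counted D E {c} c∈D c∈E ⟩
        𝟏 (counted? D E c) ∎

    -- Both sums are extended to the box and the four coordinate sums permuted, so that pairs are
    -- grouped by corner: `x` comes from the second cell and `y` from the first.
    ∑²-pairWeight : ∀ (D E : Subdiagram a b) → ∑² (pairWeight D E) ≡ + count D E
    ∑²-pairWeight D E = begin
      ∑² F
        ≡⟨ ∑-cong (cellsG a b) (λ i → ∑-cellsG (F i) λ j j∉G →
             *-zeroˡ-≡ (κF i j) (*-zeroʳ-≡ (χ D i) (χ-∉G E j∉G))) ⟩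
      ∑ (cellsG a b) (λ i → ∑ (upTo b) λ x → ∑ (upTo a) λ v → F i (+ x , + v))
        ≡⟨ ∑-cellsG _ (λ i i∉G → trans
             (∑-cong (upTo b) λ x → trans
               (∑-cong (upTo a) λ v →
                 *-zeroˡ-≡ (κF i (+ x , + v)) (*-zeroˡ-≡ (χ E (+ x , + v)) (χ-∉G D i∉G)))
               (∑-zero (upTo a)))
             (∑-zero (upTo b))) ⟩
      ∑ (upTo b) (λ k → ∑ (upTo a) λ y → ∑ (upTo b) λ x → T k y x)
        ≡⟨ ∑-cong (upTo b) (λ k → ∑-swap (upTo a) (upTo b) (T k)) ⟩
      ∑ (upTo b) (λ k → ∑ (upTo b) λ x → ∑ (upTo a) λ y → T k y x)
        ≡⟨ ∑-swap (upTo b) (upTo b) (λ k x → ∑ (upTo a) λ y → T k y x) ⟩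
      ∑ (upTo b) (λ x → ∑ (upTo b) λ k → ∑ (upTo a) λ y → T k y x)
        ≡⟨ ∑-cong (upTo b) (λ x → ∑-swap (upTo b) (upTo a) (λ k y → T k y x)) ⟩
      ∑ (upTo b) (λ x → ∑ (upTo a) λ y → ∑ (upTo b) λ k → T k y x)
        ≡⟨ ∑-cong (upTo b) (λ x → ∑-cong (upTo a) (pairWeight-fibre D E x)) ⟩
      ∑ (upTo b) (λ x → ∑ (upTo a) λ y → 𝟏 (counted? D E (+ x , + y)))
        ≡⟨ ∑-cellsG (λ c → 𝟏 (counted? D E c)) (λ c c∉G →
             𝟏-no (counted? D E c) (c∉G ∘ Mem⊆G D ∘ proj₁ ∘ proj₁)) ⟨
      ∑ (cellsG a b) (λ c → 𝟏 (counted? D E c))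
        ≡⟨ length-filter≡∑ (counted? D E) (cellsG a b) ⟨
      + count D E ∎
      where
      F κF : Cell → Cell → ℤ
      F = pairWeight D E
      κF (x , y) (x′ , y′) = κℤ a b (x - x′) (y′ - y)
      T : ℕ → ℕ → ℕ → ℤ
      T k y x = ∑ (upTo a) λ v → F (+ k , + y) (+ x , + v)

    Kˢ-pairWeight : ∀ (D E : Subdiagram a b) i j → χ D i * χ E j * Kˢ a b (g a b j - g a b i) ≡
                    pairWeight D E i j + pairWeight E D j i
    Kˢ-pairWeight D E i@(x , y) j@(x′ , y′) = begin
      χχ * Kˢ a b (g a b j - g a b i)
        ≡⟨ cong (λ d → χχ * Kˢ a b d) (ring (+ a) (+ b) x y x′ y′) ⟩
      χχ * Kˢ a b (+ a * p - + b * q)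
        ≡⟨ cong (_*_ χχ) (Kˢ≡κℤ+κℤ a b 0<a 0<b p q) ⟩
      χχ * (κℤ a b p q + κℤ a b (- p) (- q))
        ≡⟨ ℤ.*-distribˡ-+ χχ (κℤ a b p q) (κℤ a b (- p) (- q)) ⟩
      χχ * κℤ a b p q + χχ * κℤ a b (- p) (- q)
        ≡⟨ cong (_+_ (χχ * κℤ a b p q)) (cong₂ _*_ (ℤ.*-comm (χ D i) (χ E j))
             (cong₂ (κℤ a b) (neg-minus x x′) (neg-minus y′ y))) ⟩
      pairWeight D E i j + pairWeight E D j i ∎
      where
      χχ p q : ℤ
      χχ = χ D i * χ E j
      p = x - x′
      q = y′ - y
      neg-minus : ∀ i j → - (i - j) ≡ j - i
      neg-minus = solve-∀
      ring : ∀ a b x y x′ y′ →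
        (a * b - a * x′ - b * y′) - (a * b - a * x - b * y) ≡ a * (x - x′) - b * (y′ - y)
      ring = solve-∀

    ∑²-K : ∀ (D E : Subdiagram a b) →
      ∑² (λ i j → K a b (g a b j - g a b i) * (χ D i * χ E j + χ E i * χ D j)) ≡
      + (count D E ℕ.+ count E D)
    ∑²-K D E = begin
      ∑² (λ i j → k i j * (χ D i * χ E j + χ E i * χ D j))
        ≡⟨ ∑²-cong (λ i j → distrib (k i j) (χ D i) (χ E j) (χ E i) (χ D j)) ⟩
      ∑² (λ i j → χ D i * χ E j * k i j + χ D j * χ E i * k i j)
        ≡⟨ ∑²-+ (λ i j → χ D i * χ E j * k i j) (λ i j → χ D j * χ E i * k i j) ⟩
      ∑² (λ i j → χ D i * χ E j * k i j) + ∑² (λ i j → χ D j * χ E i * k i j)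
        -- Renaming the pair in the second half gives both halves the factor `χ D i * χ E j`, with
        -- `K` taken at opposite differences, which combine to `Kˢ`.
        ≡⟨ cong (_+_ (∑² (λ i j → χ D i * χ E j * k i j))) (∑²-swap (λ i j → χ D j * χ E i * k i j)) ⟩
      ∑² (λ i j → χ D i * χ E j * k i j) + ∑² (λ i j → χ D i * χ E j * k j i)
        ≡⟨ ∑²-+ (λ i j → χ D i * χ E j * k i j) (λ i j → χ D i * χ E j * k j i) ⟨
      ∑² (λ i j → χ D i * χ E j * k i j + χ D i * χ E j * k j i)
        ≡⟨ ∑²-cong (λ i j → trans (sym (ℤ.*-distribˡ-+ (χ D i * χ E j) (k i j) (k j i)))
             (cong (λ d → χ D i * χ E j * (k i j + K a b d)) (neg-minus (g a b i) (g a b j)))) ⟩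
      ∑² (λ i j → χ D i * χ E j * Kˢ a b (g a b j - g a b i))
        ≡⟨ ∑²-cong (Kˢ-pairWeight D E) ⟩
      ∑² (λ i j → pairWeight D E i j + pairWeight E D j i)
        ≡⟨ ∑²-+ (pairWeight D E) (λ i j → pairWeight E D j i) ⟩
      ∑² (pairWeight D E) + ∑² (λ i j → pairWeight E D j i)
        ≡⟨ cong₂ _+_ (∑²-pairWeight D E)
             (trans (sym (∑²-swap (pairWeight E D))) (∑²-pairWeight E D)) ⟩
      + (count D E ℕ.+ count E D) ∎
      where
      k : Cell → Cell → ℤ
      k i j = K a b (g a b j - g a b i)
      distrib : ∀ k p q r s → k * (p * q + r * s) ≡ p * q * k + s * r * k
      distrib = solve-∀
      neg-minus : ∀ i j → i - j ≡ - (j - i)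
      neg-minus = solve-∀

-- Transfer of `B` from rational sums to integer sums

∑G-fromℤ : ∀ a b {h} (f : Cell → ℤ) → (∀ i → h i ≡ fromℤ (f (proj₁ i))) →
           ∑G a b h ≡ fromℤ (∑ (cellsG a b) f)
∑G-fromℤ a b {h} f eq = trans (go (elementsG a b))
  (cong (λ cs → fromℤ (∑ cs f)) (elementsG-cells a b))
  where
  go : ∀ is → foldr ℚ._+_ ℚ.0ℚ (map h is) ≡ fromℤ (∑ (map proj₁ is) f)
  go []       = refl
  go (i ∷ is) = trans (cong₂ ℚ._+_ (eq i) (go is))
    (sym (fromℤ-+ (f (proj₁ i)) (∑ (map proj₁ is) f)))

B-indicator : ∀ {a b} (D E : Subdiagram a b) → B a b (indicator D) (indicator E) ≡
  ½ ℚ.* fromℤ (∑² {a} {b} λ i j → K a b (g a b j - g a b i) * (χ D i * χ E j + χ E i * χ D j))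
B-indicator {a} {b} D E = cong (½ ℚ.*_)
  (∑G-fromℤ a b (λ i → ∑ (cellsG a b) (f i)) λ i → ∑G-fromℤ a b (f (proj₁ i)) λ j →
    entry (proj₁ i) (proj₁ j))
  where
  f : Cell → Cell → ℤ
  f i j = K a b (g a b j - g a b i) * (χ D i * χ E j + χ E i * χ D j)
  entry : ∀ i j → fromℤ (K a b (g a b j - g a b i)) ℚ.*
    (fromℤ (χ D i) ℚ.* fromℤ (χ E j) ℚ.+ fromℤ (χ E i) ℚ.* fromℤ (χ D j)) ≡ fromℤ (f i j)
  entry i j = sym (trans (fromℤ-* (K a b (g a b j - g a b i)) (χ D i * χ E j + χ E i * χ D j))
    (cong (ℚ._*_ (fromℤ (K a b (g a b j - g a b i))))
      (trans (fromℤ-+ (χ D i * χ E j) (χ E i * χ D j))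
        (cong₂ ℚ._+_ (fromℤ-* (χ D i) (χ E j)) (fromℤ-* (χ E i) (χ D j))))))

theorem1p2 : ∀ (a b : ℕ) .{{_ : NonZero b}} → 1 < a → a < b → Coprime a b →
    ∀ (D E : Subdiagram a b) → B a b (indicator D) (indicator E) ≡ dinv D E
theorem1p2 a b 1<a a<b _ D E = trans (B-indicator D E)
  (cong (λ n → ½ ℚ.* fromℤ n) (∑²-K (ℕ.<⇒≤ 1<a) (ℕ.≤-trans (s≤s z≤n) a<b) D E))
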